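{- Let $\mathcal{F}\subseteq\binom{[n]}{k}$ and let $m\ge2$. Then, writing $\beta_{k,m}=(25\cdot 2^k k m)^{ -k}$, there exists a subfamily $\mathcal{F}'\subseteq\mathcal{F}$ with $|\mathcal{F}'|\ge\beta_{k,m}|\mathcal{F}|$ such that (a) for every distinct $F_1,F_2\in\mathcal{F}'$ there is a sunflower in $\mathcal{F}$ with $m$ petals whose kernel is $F_1\cap F_2$; (b) in fact, for every $F\in\mathcal{F}'$ there exists an intersection-closed set system $\mathcal{I}_F$ with $I(F,\mathcal{F}')\subseteq\mathcal{I}_F\subseteq 2^F\setminus\{F\}$ such that every element of $\mathcal{I}_F$ is the kernel of a sunflower with $m$ petals in $\mathcal{F}$.
   Context: $\binom{[n]}{k}$ is the set of $k$-element subsets of $\{1,\dots,n\}$. A sunflower with $t$ petals is a collection of distinct sets $F_1,\dots,F_t$ with $F_i\cap F_j=\bigcap_\ell F_\ell$ for all $i\ne j$; this common intersection is the kernel. For $F\in\mathcal F'$, $I(F,\mathcal F')=\{F\cap F':F'\in\mathcal F'\setminus\{F\}\}$. A set system is intersection-closed if it contains $I\cap I'$ whenever it contains $I,I'$. -}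

module Defs where

open import Data.Nat using (ℕ; _≤_; _*_; _^_)
open import Data.Fin using (Fin)
open import Data.Fin.Subset using (Subset; _∩_; _⊆_; ∣_∣)
open import Data.List using (List; length)
open import Data.List.Relation.Unary.All using (All)
open import Data.List.Relation.Unary.Unique.Propositional using (Unique)
import Data.List.Membership.Propositional as L
open import Data.Product using (Σ; _×_)
open import Relation.Binary.PropositionalEquality using (_≡_; _≢_)
open import Function.Definitions using (Injective)

-- A family of subsets of [n] is a duplicate-free list of subsets
-- (Subset n = characteristic vectors); |𝓕| = length.
Family : ℕ → Set
Family n = List (Subset n)

Uniform : ∀ {n} → ℕ → Family n → Set
Uniform k 𝓕 = All (λ A → ∣ A ∣ ≡ k) 𝓕

_⊑_ : ∀ {n} → Family n → Family n → Set
𝓖 ⊑ 𝓕 = ∀ {A} → A L.∈ 𝓖 → A L.∈ 𝓕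

-- A sunflower in 𝓕 with m petals and kernel K: m distinct members of 𝓕
-- whose pairwise intersections all equal K (for m ≥ 2 this common value is
-- exactly the intersection of all petals).
record SunflowerIn {n} (𝓕 : Family n) (m : ℕ) (K : Subset n) : Set where
  field
    petal    : Fin m → Subset n
    distinct : Injective _≡_ _≡_ petal
    inFam    : ∀ i → petal i L.∈ 𝓕
    kernel   : ∀ i j → i ≢ j → (petal i ∩ petal j) ≡ K

IntersectionClosed : ∀ {n} → Family n → Set
IntersectionClosed 𝓘 = ∀ {I J} → I L.∈ 𝓘 → J L.∈ 𝓘 → (I ∩ J) L.∈ 𝓘

ISub : ∀ {n} → Subset n → Family n → Family n → Set
ISub F 𝓕′ 𝓘 = ∀ {G} → G L.∈ 𝓕′ → G ≢ F → (F ∩ G) L.∈ 𝓘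

ProperSubsetsOf : ∀ {n} → Subset n → Family n → Set
ProperSubsetsOf F 𝓘 = ∀ {I} → I L.∈ 𝓘 → I ⊆ F × I ≢ F

{-# OPTIONS --safe #-}
-- If I is not the kernel of an m-petal sunflower in 𝓕, the union C I of a maximal sunflower with
-- kernel I has at most m k elements, and no member of 𝓕 properly containing I meets C I inside I
-- only.  Let B F be the union of the C I over the non-kernels I ⊆ F, so ∣ B F ∣ ≤ b = 2 ^ k · m k,
-- choose a random R ⊆ [n] containing each point with probability 1 / 2b, and let 𝓕′ consist of
-- the F ∈ 𝓕 with F ⊆ R and B F ∩ R ⊆ F.  Suppose I ⊊ F ∈ 𝓕′ is an intersection of members of 𝓕′
-- but not a kernel.  Then C I ∩ R lies in every member of 𝓕′ containing I, hence in I, and so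
-- F ⊆ R meets C I inside I only, a contradiction.  Thus 𝓘_F can be taken to consist of all proper
-- subsets of F that are intersections of members of 𝓕′.
module Submission where

open import Defs
open import Data.Nat using (ℕ; _≤_; _*_; _^_)
open import Data.Fin.Subset using (Subset; _∩_)
open import Data.List using (length)
open import Data.List.Relation.Unary.Unique.Propositional using (Unique)
open import Data.List.Membership.Propositional using (_∈_)
open import Data.Product using (Σ; _×_)
open import Relation.Binary.PropositionalEquality using (_≢_)

open import Data.Bool using (Bool; true; false; not; _∧_; T; T?; if_then_else_)
open import Data.Fin using (Fin; zero; suc)
open import Data.Fin.Properties using (all?; any?)
open import Data.Fin.Subset using (_⊆_; _⊈_; _∪_; ⋃; ∣_∣; inside; outside; ⊥)
  renaming (_∈_ to _∈ˢ_)
open import Data.Fin.Subset.Properties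
  using (_⊆?_; _∈?_; p∩q⊆p; p∩q⊆q; x∈p∩q⁺; x∈p∩q⁻; p⊆p∪q; q⊆p∪q; ⊥⊆; ∣⊥∣≡0;
         ∩-comm; p⊂q⇒∣p∣<∣q∣; ⊆-antisym; ⊆-trans; out⊆; drop-∷-⊆; s⊆s)
open import Data.List using (List; []; _∷_; _++_; map; filter)
open import Data.List.Membership.Propositional.Properties
  using (∈-map⁺; ∈-++⁺ˡ; ∈-++⁺ʳ; ∈-filter⁺; ∈-filter⁻)
open import Data.List.Membership.Propositional using (find; lose)
open import Data.List.Properties using (length-++; length-map)
open import Data.List.Relation.Unary.All as All using (All)
open import Data.List.Relation.Unary.Any as Any using (here; there)
open import Data.List.Relation.Unary.Unique.Propositional.Properties using () renaming (filter⁺ to unique-filter⁺)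
open import Data.Nat using (zero; suc; _+_; z≤n; s≤s; s≤s⁻¹; pred; NonZero; >-nonZero; ≢-nonZero)
open import Data.Nat.Properties
open import Data.Nat.Tactic.RingSolver using (solve-∀)
open import Data.Product using (∃; _,_; proj₁; proj₂)
open import Data.Sum using (_⊎_; inj₁; inj₂)
open import Data.Vec using ([]; _∷_; here)
open import Data.Vec.Functional using () renaming (_∷_ to _∷ᶠ_)
open import Algebra.Properties.CommutativeSemigroup *-commutativeSemigroup using (x∙yz≈y∙xz)
open import Function using (_∘_)
open import Relation.Binary.PropositionalEquality
  using (_≡_; refl; sym; trans; cong; cong₂; subst)
open import Relation.Nullary using (Dec; yes; no; ¬_; ¬?; contradiction)
open import Relation.Nullary.Decidable using (_×-dec_; _→-dec_; decidable-stable)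

private
  variable
    n : ℕ

-- Weighted averages over random subsets

indicator : Bool → ℕ
indicator b = if b then 1 else 0

length-filter-∷ : {X : Set} (p : X → Bool) (x : X) (xs : List X) →
  length (filter (T? ∘ p) (x ∷ xs)) ≡ indicator (p x) + length (filter (T? ∘ p) xs)
length-filter-∷ p x xs with p x
... | true  = refl
... | false = refl

module _ (q : ℕ) where

  private
    Q : ℕ
    Q = suc q

  -- Q ^ n times the expectation of f at a random subset containing each point with
  -- probability 1 / Q.
  𝔼 : (Subset n → ℕ) → ℕ
  𝔼 {zero}  f = f []
  𝔼 {suc n} f = 𝔼 (f ∘ (inside ∷_)) + q * 𝔼 (f ∘ (outside ∷_))

  𝔼-cong : {f g : Subset n → ℕ} → (∀ R → f R ≡ g R) → 𝔼 f ≡ 𝔼 g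
  𝔼-cong {zero}  f≗g = f≗g []
  𝔼-cong {suc n} f≗g =
    cong₂ (λ x y → x + q * y) (𝔼-cong (f≗g ∘ (inside ∷_))) (𝔼-cong (f≗g ∘ (outside ∷_)))

  𝔼-+ : (f g : Subset n → ℕ) → 𝔼 (λ R → f R + g R) ≡ 𝔼 f + 𝔼 g
  𝔼-+ {zero}  f g = refl
  𝔼-+ {suc n} f g
    rewrite 𝔼-+ (f ∘ (inside ∷_)) (g ∘ (inside ∷_))
          | 𝔼-+ (f ∘ (outside ∷_)) (g ∘ (outside ∷_)) =
      rearrange (𝔼 (f ∘ (inside ∷_))) _ (𝔼 (f ∘ (outside ∷_))) _ q
    where
    rearrange : ∀ a b c d e → a + b + e * (c + d) ≡ a + e * c + (b + e * d)
    rearrange = solve-∀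

  -- `Q ^ n` is the total weight of all subsets, so some value is at least the average; of the best
  -- values in the two halves the larger is kept.
  𝔼≤max : (f : Subset n → ℕ) → ∃ λ R → 𝔼 f ≤ Q ^ n * f R
  𝔼≤max {zero}  f = [] , ≤-reflexive (sym (+-identityʳ (f [])))
  𝔼≤max {suc n} f with 𝔼≤max (f ∘ (inside ∷_)) | 𝔼≤max (f ∘ (outside ∷_))
  ... | R , le | S , le′ with ≤-total (f (inside ∷ R)) (f (outside ∷ S))
  ...   | inj₁ R≤S = outside ∷ S , (begin
    𝔼 (f ∘ (inside ∷_)) + q * 𝔼 (f ∘ (outside ∷_))
      ≤⟨ +-mono-≤ (≤-trans le (*-monoʳ-≤ (Q ^ n) R≤S)) (*-monoʳ-≤ q le′) ⟩
    Q * (Q ^ n * f (outside ∷ S))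
      ≡⟨ *-assoc Q (Q ^ n) _ ⟨
    Q * Q ^ n * f (outside ∷ S) ∎)
    where open ≤-Reasoning
  ...   | inj₂ S≤R = inside ∷ R , (begin
    𝔼 (f ∘ (inside ∷_)) + q * 𝔼 (f ∘ (outside ∷_))
      ≤⟨ +-mono-≤ le (*-monoʳ-≤ q (≤-trans le′ (*-monoʳ-≤ (Q ^ n) S≤R))) ⟩
    Q * (Q ^ n * f (inside ∷ R))
      ≡⟨ *-assoc Q (Q ^ n) _ ⟨
    Q * Q ^ n * f (inside ∷ R) ∎)
    where open ≤-Reasoning

  -- Linearity of expectation; the lower bound `c / d` for each element is kept as a pair to avoid
  -- division.
  𝔼-length-filter : {X : Set} (p : Subset n → X → Bool) {c d : ℕ} {xs : List X} →
    All (λ x → c ≤ 𝔼 (λ R → indicator (p R x)) * d) xs →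
    length xs * c ≤ 𝔼 (λ R → length (filter (T? ∘ p R) xs)) * d
  𝔼-length-filter p All.[] = z≤n
  𝔼-length-filter p {c} {d} {x ∷ xs} (px All.∷ pxs) = begin
    c + length xs * c
      ≤⟨ +-mono-≤ px (𝔼-length-filter p pxs) ⟩
    𝔼 (λ R → indicator (p R x)) * d + 𝔼 (λ R → length (filter (T? ∘ p R) xs)) * d
      ≡⟨ *-distribʳ-+ d (𝔼 (λ R → indicator (p R x))) _ ⟨
    (𝔼 (λ R → indicator (p R x)) + 𝔼 (λ R → length (filter (T? ∘ p R) xs))) * d
      ≡⟨ cong (_* d) (𝔼-+ (λ R → indicator (p R x)) _) ⟨
    𝔼 (λ R → indicator (p R x) + length (filter (T? ∘ p R) xs)) * d
      ≡⟨ cong (_* d) (𝔼-cong (λ R → length-filter-∷ (p R) x xs)) ⟨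
    𝔼 (λ R → length (filter (T? ∘ p R) (x ∷ xs))) * d ∎
    where open ≤-Reasoning

-- Survival of a set under a random restriction.

-- Tests `A ⊆ R` and `B ∩ R ⊆ A` together, as one independent condition per point, so that its
-- expectation factors along the recursion of `𝔼`.
fits : Subset n → Subset n → Subset n → Bool
fits []      []            []            = true
fits (r ∷ R) (inside  ∷ A) (b       ∷ B) = r ∧ fits R A B
fits (r ∷ R) (outside ∷ A) (inside  ∷ B) = not r ∧ fits R A B
fits (r ∷ R) (outside ∷ A) (outside ∷ B) = fits R A B

fits⇒⊆ : (R A B : Subset n) → T (fits R A B) → A ⊆ R
fits⇒⊆ (inside  ∷ R) (inside  ∷ A) (_       ∷ B) t = s⊆s (fits⇒⊆ R A B t)
fits⇒⊆ (outside ∷ R) (outside ∷ A) (inside  ∷ B) t = out⊆ (fits⇒⊆ R A B t)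
fits⇒⊆ (_       ∷ R) (outside ∷ A) (outside ∷ B) t = out⊆ (fits⇒⊆ R A B t)
fits⇒⊆ []            []            []            t = λ x∈ → x∈

fits⇒∩⊆ : (R A B : Subset n) → T (fits R A B) → B ∩ R ⊆ A
fits⇒∩⊆ (inside  ∷ R) (inside  ∷ A) (inside  ∷ B) t = s⊆s (fits⇒∩⊆ R A B t)
fits⇒∩⊆ (inside  ∷ R) (inside  ∷ A) (outside ∷ B) t = out⊆ (fits⇒∩⊆ R A B t)
fits⇒∩⊆ (outside ∷ R) (outside ∷ A) (inside  ∷ B) t = out⊆ (fits⇒∩⊆ R A B t)
fits⇒∩⊆ (_       ∷ R) (outside ∷ A) (outside ∷ B) t = out⊆ (fits⇒∩⊆ R A B t)
fits⇒∩⊆ []            []            []            t = λ x∈ → x∈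

-- Bernoulli's inequality (1 - 1/Q) ^ ∣ B ∣ ≥ 1 - ∣ B ∣ / Q, with r ≤ Q - ∣ B ∣.
𝔼-fits-≥ : (q : ℕ) (A B : Subset n) {r : ℕ} → r + ∣ B ∣ ≤ suc q →
  suc q ^ n * r ≤ 𝔼 q (λ R → indicator (fits R A B)) * suc q ^ suc ∣ A ∣
𝔼-fits-≥ q [] [] {r} r≤Q = begin
  1 * r              ≡⟨ *-identityˡ r ⟩
  -- The extra `Q` in `Q ^ suc ∣ A ∣` is the denominator of the bound `r / Q`.
  r                  ≤⟨ m+n≤o⇒m≤o r r≤Q ⟩
  suc q              ≡⟨ *-identityʳ (suc q) ⟨
  suc q * 1          ≡⟨ *-identityˡ _ ⟨
  1 * (suc q * 1)    ∎
  where open ≤-Reasoning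
𝔼-fits-≥ {suc n} q (inside ∷ A) (b ∷ B) {r} r≤Q = begin
  Q * Q ^ n * r        ≡⟨ *-assoc Q (Q ^ n) r ⟩
  Q * (Q ^ n * r)      ≤⟨ *-monoʳ-≤ Q (𝔼-fits-≥ q A B (≤-trans (+-monoʳ-≤ r (∣B∣≤ b)) r≤Q)) ⟩
  Q * (E * Q ^ suc ∣ A ∣) ≡⟨ x∙yz≈y∙xz Q E (Q ^ suc ∣ A ∣) ⟩
  E * (Q * Q ^ suc ∣ A ∣) ≤⟨ *-monoˡ-≤ _ (m≤m+n E _) ⟩
  (E + q * 𝔼 q {n} (λ R → 0)) * (Q * Q ^ suc ∣ A ∣) ∎
  where
  open ≤-Reasoning
  Q = suc q
  E = 𝔼 q (λ R → indicator (fits R A B))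
  ∣B∣≤ : ∀ b → ∣ B ∣ ≤ ∣ b ∷ B ∣
  ∣B∣≤ inside  = n≤1+n _
  ∣B∣≤ outside = ≤-refl
𝔼-fits-≥ {suc n} q (outside ∷ A) (inside ∷ B) {r} r≤Q = begin
  Q * Q ^ n * r          ≡⟨ shuffle Q (Q ^ n) r ⟩
  -- The point must miss `R`, which has weight `q`; in exchange `B` loses a point and `r` rises to
  -- `suc r`. The inequality amounts to `r ≤ q`.
  Q ^ n * (Q * r)        ≤⟨ *-monoʳ-≤ (Q ^ n) Qr≤ ⟩
  Q ^ n * (q * suc r)    ≡⟨ x∙yz≈y∙xz (Q ^ n) q (suc r) ⟩
  q * (Q ^ n * suc r)    ≤⟨ *-monoʳ-≤ q (𝔼-fits-≥ q A B r+1≤Q) ⟩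
  q * (E * D)            ≡⟨ *-assoc q E D ⟨
  q * E * D              ≤⟨ *-monoˡ-≤ D (m≤n+m (q * E) (𝔼 q {n} (λ R → 0))) ⟩
  (𝔼 q {n} (λ R → 0) + q * E) * D ∎
  where
  open ≤-Reasoning
  Q = suc q
  E = 𝔼 q (λ R → indicator (fits R A B))
  D = Q ^ suc ∣ A ∣
  r+1≤Q : suc r + ∣ B ∣ ≤ Q
  r+1≤Q = subst (_≤ Q) (+-suc r ∣ B ∣) r≤Q
  Qr≤ : Q * r ≤ q * suc r
  Qr≤ = begin
    r + q * r  ≤⟨ +-monoˡ-≤ (q * r) (s≤s⁻¹ (m+n≤o⇒m≤o (suc r) r+1≤Q)) ⟩
    q + q * r  ≡⟨ *-suc q r ⟨
    q * suc r  ∎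
  shuffle : ∀ a b c → a * b * c ≡ b * (a * c)
  shuffle = solve-∀
𝔼-fits-≥ {suc n} q (outside ∷ A) (outside ∷ B) {r} r≤Q = begin
  Q * Q ^ n * r        ≡⟨ *-assoc Q (Q ^ n) r ⟩
  Q * (Q ^ n * r)      ≤⟨ *-monoʳ-≤ Q (𝔼-fits-≥ q A B r≤Q) ⟩
  Q * (E * D)          ≡⟨ *-assoc Q E D ⟨
  Q * E * D            ∎
  where
  open ≤-Reasoning
  Q = suc q
  E = 𝔼 q (λ R → indicator (fits R A B))
  D = Q ^ suc ∣ A ∣

-- First moment method: each `F` survives with probability at least `r / Q ^ suc k`, so some `R`
-- keeps at least that fraction of `𝓕`.
good-restriction : (q k r : ℕ) (B : Subset n → Subset n) (𝓕 : Family n) → Uniform k 𝓕 →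
  All (λ F → r + ∣ B F ∣ ≤ suc q) 𝓕 →
  ∃ λ R → length 𝓕 * r ≤ length (filter (λ F → T? (fits R F (B F))) 𝓕) * suc q ^ suc k
good-restriction {n} q k r B 𝓕 uniform small = R , *-cancelˡ-≤ (Q ^ n) {{m^n≢0 Q n}} (begin
  Q ^ n * (length 𝓕 * r)           ≡⟨ x∙yz≈y∙xz (Q ^ n) (length 𝓕) r ⟩
  length 𝓕 * (Q ^ n * r)           ≤⟨ 𝔼-length-filter q (λ R F → fits R F (B F)) bounds ⟩
  𝔼 q survivors * Q ^ suc k        ≤⟨ *-monoˡ-≤ (Q ^ suc k) 𝔼≤ ⟩
  Q ^ n * survivors R * Q ^ suc k  ≡⟨ *-assoc (Q ^ n) (survivors R) _ ⟩
  Q ^ n * (survivors R * Q ^ suc k) ∎)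
  where
  open ≤-Reasoning
  Q = suc q
  survivors : Subset n → ℕ
  survivors R = length (filter (λ F → T? (fits R F (B F))) 𝓕)
  R = proj₁ (𝔼≤max q survivors)
  𝔼≤ = proj₂ (𝔼≤max q survivors)
  bounds : All (λ F → Q ^ n * r ≤ 𝔼 q (λ R → indicator (fits R F (B F))) * Q ^ suc k) 𝓕
  bounds = All.zipWith (λ { {F} (refl , s) → 𝔼-fits-≥ q F (B F) s }) (uniform , small)

-- Subsets and unions

subsets : Subset n → List (Subset n)
subsets []            = [] ∷ []
subsets (inside  ∷ A) = map (inside ∷_) (subsets A) ++ map (outside ∷_) (subsets A)
subsets (outside ∷ A) = map (outside ∷_) (subsets A)

length-subsets : (A : Subset n) → length (subsets A) ≡ 2 ^ ∣ A ∣
length-subsets []            = refl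
length-subsets (inside  ∷ A) = trans (length-++ (map (inside ∷_) (subsets A)))
  (cong₂ _+_ (half inside) (trans (half outside) (sym (+-identityʳ _))))
  where
  half : ∀ s → length (map (s ∷_) (subsets A)) ≡ 2 ^ ∣ A ∣
  half s = trans (length-map (s ∷_) (subsets A)) (length-subsets A)
length-subsets (outside ∷ A) = trans (length-map (outside ∷_) (subsets A)) (length-subsets A)

⊆⇒∈-subsets : (I A : Subset n) → I ⊆ A → I ∈ subsets A
⊆⇒∈-subsets []            []            I⊆A = here refl
⊆⇒∈-subsets (inside  ∷ I) (inside  ∷ A) I⊆A =
  ∈-++⁺ˡ (∈-map⁺ (inside ∷_) (⊆⇒∈-subsets I A (drop-∷-⊆ I⊆A)))
⊆⇒∈-subsets (outside ∷ I) (inside  ∷ A) I⊆A =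
  ∈-++⁺ʳ (map (inside ∷_) (subsets A)) (∈-map⁺ (outside ∷_) (⊆⇒∈-subsets I A (drop-∷-⊆ I⊆A)))
⊆⇒∈-subsets (outside ∷ I) (outside ∷ A) I⊆A =
  ∈-map⁺ (outside ∷_) (⊆⇒∈-subsets I A (drop-∷-⊆ I⊆A))
⊆⇒∈-subsets (inside  ∷ I) (outside ∷ A) I⊆A with I⊆A here
... | ()

∣p∣≡∣q∣∧p⊆q⇒p≡q : {p q : Subset n} → ∣ p ∣ ≡ ∣ q ∣ → p ⊆ q → p ≡ q
∣p∣≡∣q∣∧p⊆q⇒p≡q {p = p} {q} eq p⊆q with q ⊆? p
... | yes q⊆p = ⊆-antisym p⊆q q⊆p
... | no  q⊈p = contradiction eq (<⇒≢ (p⊂q⇒∣p∣<∣q∣ (p⊆q , witness)))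
  where
  witness : ∃ λ x → x ∈ˢ q × ¬ (x ∈ˢ p)
  witness with any? (λ x → (x ∈? q) ×-dec ¬? (x ∈? p))
  ... | yes w = w
  ... | no ¬w = contradiction (λ {x} x∈q → decidable-stable (x ∈? p) (λ x∉p → ¬w (x , x∈q , x∉p))) q⊈p

∣p∪q∣≤∣p∣+∣q∣ : (p q : Subset n) → ∣ p ∪ q ∣ ≤ ∣ p ∣ + ∣ q ∣
∣p∪q∣≤∣p∣+∣q∣ []            []            = z≤n
∣p∪q∣≤∣p∣+∣q∣ (inside  ∷ p) (inside  ∷ q) =
  s≤s (≤-trans (∣p∪q∣≤∣p∣+∣q∣ p q) (+-monoʳ-≤ ∣ p ∣ (n≤1+n ∣ q ∣)))
∣p∪q∣≤∣p∣+∣q∣ (inside  ∷ p) (outside ∷ q) = s≤s (∣p∪q∣≤∣p∣+∣q∣ p q)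
∣p∪q∣≤∣p∣+∣q∣ (outside ∷ p) (inside  ∷ q) =
  ≤-trans (s≤s (∣p∪q∣≤∣p∣+∣q∣ p q)) (≤-reflexive (sym (+-suc ∣ p ∣ ∣ q ∣)))
∣p∪q∣≤∣p∣+∣q∣ (outside ∷ p) (outside ∷ q) = ∣p∪q∣≤∣p∣+∣q∣ p q

module _ {X : Set} (C : X → Subset n) where

  ∣⋃∣≤ : {b : ℕ} → (∀ x → ∣ C x ∣ ≤ b) → ∀ xs → ∣ ⋃ (map C xs) ∣ ≤ length xs * b
  ∣⋃∣≤ bound []       = ≤-reflexive (∣⊥∣≡0 n)
  ∣⋃∣≤ bound (x ∷ xs) = ≤-trans (∣p∪q∣≤∣p∣+∣q∣ (C x) (⋃ (map C xs)))
    (+-mono-≤ (bound x) (∣⋃∣≤ bound xs))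

  ⊆⋃ : ∀ {x xs} → x ∈ xs → C x ⊆ ⋃ (map C xs)
  ⊆⋃ {xs = y ∷ ys} (here refl)  = p⊆p∪q (⋃ (map C ys))
  ⊆⋃ {xs = y ∷ ys} (there x∈ys) = q⊆p∪q (C y) _ ∘ ⊆⋃ x∈ys

-- Greedy sunflowers

-- When `C` is the union of a sunflower with kernel `I`, this says that no member properly
-- containing `I` can be added as a petal.
Covers : Family n → Subset n → Subset n → Set
Covers 𝓕 I C = ∀ {G} → G ∈ 𝓕 → I ⊆ G → G ⊈ I → G ∩ C ⊈ I

module _ {k : ℕ} {𝓕 : Family n} (uniform : Uniform k 𝓕) (I : Subset n) where

  -- `kernel⊆` is recorded separately because `kernel` says nothing about a single petal.
  record BoundedSunflower (m : ℕ) : Set where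
    field
      sunflower : SunflowerIn 𝓕 m I
    open SunflowerIn sunflower public
    field
      kernel⊆ : ∀ i → I ⊆ petal i
      union   : Subset n
      petal⊆  : ∀ i → petal i ⊆ union
      size    : ∣ union ∣ ≤ m * k

  emptySunflower : BoundedSunflower 0
  emptySunflower = record
    { sunflower = record
      { petal = λ () ; distinct = λ { {()} } ; inFam = λ () ; kernel = λ () }
    ; kernel⊆ = λ () ; union = ⊥ ; petal⊆ = λ () ; size = ≤-reflexive (∣⊥∣≡0 n) }

  module _ {m : ℕ} (S : BoundedSunflower m) {G : Subset n} (G∈𝓕 : G ∈ 𝓕)
    (I⊆G : I ⊆ G) (G⊈I : G ⊈ I) (trace : G ∩ BoundedSunflower.union S ⊆ I) where

    open BoundedSunflower S

    private
      G≢petal : ∀ i → G ≢ petal i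
      -- A petal lies inside `union`, so `trace` would force it into `I`.
      G≢petal i refl = G⊈I (λ x∈G → trace (x∈p∩q⁺ (x∈G , petal⊆ i x∈G)))

      G∩petal : ∀ i → G ∩ petal i ≡ I
      G∩petal i = ⊆-antisym
        (λ x∈ → let x∈G , x∈P = x∈p∩q⁻ G (petal i) x∈ in trace (x∈p∩q⁺ (x∈G , petal⊆ i x∈P)))
        (λ x∈I → x∈p∩q⁺ (I⊆G x∈I , kernel⊆ i x∈I))

    extend : BoundedSunflower (suc m)
    extend = record
      { sunflower = record
        { petal    = G ∷ᶠ petal
        ; distinct = λ { {zero}  {zero}  _  → refl
                       ; {zero}  {suc j} eq → contradiction eq (G≢petal j)
                       ; {suc i} {zero}  eq → contradiction (sym eq) (G≢petal i)
                       ; {suc i} {suc j} eq → cong suc (distinct eq) }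
        ; inFam    = λ { zero → G∈𝓕 ; (suc i) → inFam i }
        ; kernel   = λ { zero    zero    0≢0 → contradiction refl 0≢0
                       ; zero    (suc j) _   → G∩petal j
                       ; (suc i) zero    _   → trans (∩-comm (petal i) G) (G∩petal i)
                       ; (suc i) (suc j) i≢j → kernel i j (i≢j ∘ cong suc) }
        }
      ; kernel⊆ = λ { zero → I⊆G ; (suc i) → kernel⊆ i }
      ; union   = G ∪ union
      ; petal⊆  = λ { zero → p⊆p∪q union ; (suc i) → q⊆p∪q G union ∘ petal⊆ i }
      ; size    = ≤-trans (∣p∪q∣≤∣p∣+∣q∣ G union)
                    (+-mono-≤ (≤-reflexive (All.lookup uniform G∈𝓕)) size)
      }

  private
    extends? : ∀ C (G : Subset n) → Dec (I ⊆ G × G ⊈ I × G ∩ C ⊆ I)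
    extends? C G = (I ⊆? G) ×-dec ¬? (G ⊆? I) ×-dec (G ∩ C ⊆? I)

  -- A sunflower that gets stuck before `m` petals leaves its union as a cover; a cover found early
  -- stays valid because the size bound only grows.
  greedy : ∀ m → BoundedSunflower m ⊎ ∃ λ C → ∣ C ∣ ≤ m * k × Covers 𝓕 I C
  greedy zero = inj₁ emptySunflower
  greedy (suc m) with greedy m
  ... | inj₂ (C , size , covers) = inj₂ (C , ≤-trans size (m≤n+m (m * k) k) , covers)
  ... | inj₁ S with Any.any? (extends? (BoundedSunflower.union S)) 𝓕
  ...   | yes ext = let G , G∈𝓕 , I⊆G , G⊈I , trace = find ext
                    in inj₁ (extend S G∈𝓕 I⊆G G⊈I trace)
  ...   | no ¬ext = inj₂ (BoundedSunflower.union S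
                   , ≤-trans (BoundedSunflower.size S) (m≤n+m (m * k) k)
                   , λ G∈𝓕 I⊆G G⊈I trace → ¬ext (lose G∈𝓕 (I⊆G , G⊈I , trace)))

  -- `C` is pulled out of the alternative so that it exists for every `I`; when a sunflower is found
  -- it is `⊥`, which adds nothing to the unions formed later.
  sunflowerOrCover : ∀ m → ∃ λ C → ∣ C ∣ ≤ m * k × (SunflowerIn 𝓕 m I ⊎ Covers 𝓕 I C)
  sunflowerOrCover m with greedy m
  ... | inj₁ S = ⊥ , ≤-trans (≤-reflexive (∣⊥∣≡0 n)) z≤n , inj₁ (BoundedSunflower.sunflower S)
  ... | inj₂ (C , size , covers) = C , size , inj₂ covers

-- Intersections of members of a family

-- The ground set [n] counts as the empty intersection.
Closed : Family n → Subset n → Set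
Closed {n} 𝓖 I = (x : Fin n) → All (λ G → I ⊆ G → x ∈ˢ G) 𝓖 → x ∈ˢ I

closed? : (𝓖 : Family n) (I : Subset n) → Dec (Closed 𝓖 I)
closed? 𝓖 I = all? λ x → All.all? (λ G → (I ⊆? G) →-dec (x ∈? G)) 𝓖 →-dec (x ∈? I)

closed-∈ : {𝓖 : Family n} {G : Subset n} → G ∈ 𝓖 → Closed 𝓖 G
closed-∈ G∈𝓖 x h = All.lookup h G∈𝓖 (λ y∈ → y∈)

-- Members containing `I` or `J` contain `I ∩ J`, so a point common to all members above `I ∩ J`
-- lies in both.
closed-∩ : {𝓖 : Family n} {I J : Subset n} → Closed 𝓖 I → Closed 𝓖 J → Closed 𝓖 (I ∩ J)
closed-∩ {I = I} {J} cI cJ x h = x∈p∩q⁺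
  ( cI x (All.tabulate λ G∈ I⊆G → All.lookup h G∈ (I⊆G ∘ p∩q⊆p I J))
  , cJ x (All.tabulate λ G∈ J⊆G → All.lookup h G∈ (J⊆G ∘ p∩q⊆q I J)))

module _ (𝓖 : Family n) (F : Subset n) where

  private
    inIntersections? : ∀ I → Dec (I ⊆ F × F ⊈ I × Closed 𝓖 I)
    inIntersections? I = (I ⊆? F) ×-dec ¬? (F ⊆? I) ×-dec closed? 𝓖 I

  properIntersections : Family n
  properIntersections = filter inIntersections? (subsets F)

  ∈-properIntersections⁺ : ∀ {I} → I ⊆ F → F ⊈ I → Closed 𝓖 I → I ∈ properIntersections
  ∈-properIntersections⁺ {I} I⊆F F⊈I closed =
    ∈-filter⁺ inIntersections? (⊆⇒∈-subsets I F I⊆F) (I⊆F , F⊈I , closed)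

  ∈-properIntersections⁻ : ∀ {I} → I ∈ properIntersections → I ⊆ F × F ⊈ I × Closed 𝓖 I
  ∈-properIntersections⁻ I∈ = proj₂ (∈-filter⁻ inIntersections? {xs = subsets F} I∈)

  properIntersections-closed : IntersectionClosed properIntersections
  properIntersections-closed {I} {J} I∈ J∈ =
    let I⊆F , F⊈I , cI = ∈-properIntersections⁻ I∈
        _   , _   , cJ = ∈-properIntersections⁻ J∈
    in ∈-properIntersections⁺ (⊆-trans (p∩q⊆p I J) I⊆F)
         (λ F⊆I∩J → F⊈I (⊆-trans F⊆I∩J (p∩q⊆p I J))) (closed-∩ cI cJ)

  properIntersections-proper : ProperSubsetsOf F properIntersections
  properIntersections-proper I∈ =
    let I⊆F , F⊈I , _ = ∈-properIntersections⁻ I∈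
    in I⊆F , λ { refl → F⊈I (λ x∈ → x∈) }

-- Members have equal size, so `F ⊆ G` would force equality.
∩-member-proper : {k : ℕ} {𝓕 : Family n} → Uniform k 𝓕 → ∀ {F G} → F ∈ 𝓕 → G ∈ 𝓕 → G ≢ F →
  F ⊈ F ∩ G
∩-member-proper uniform {F} {G} F∈𝓕 G∈𝓕 G≢F F⊆F∩G = G≢F (sym (∣p∣≡∣q∣∧p⊆q⇒p≡q
  (trans (All.lookup uniform F∈𝓕) (sym (All.lookup uniform G∈𝓕)))
  (⊆-trans F⊆F∩G (p∩q⊆q F G))))

-- One of the `k` factors absorbs the leading 2, since `4 ≤ 25`. At `k = 0` this would read `2 ≤ 1`;
-- that case is treated apart.
2*[2b]^k≤[25b]^k : ∀ b k .{{_ : NonZero k}} → 2 * (2 * b) ^ k ≤ (25 * b) ^ k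
2*[2b]^k≤[25b]^k b k@(suc l) = begin
  2 * ((2 * b) * (2 * b) ^ l) ≡⟨ shuffle b ((2 * b) ^ l) ⟩
  (4 * b) * (2 * b) ^ l       ≤⟨ *-mono-≤ (*-monoˡ-≤ b 4≤25) (^-monoˡ-≤ l (*-monoˡ-≤ b 2≤25)) ⟩
  (25 * b) * (25 * b) ^ l     ∎
  where
  open ≤-Reasoning
  4≤25 : 4 ≤ 25
  4≤25 = m≤m+n 4 21
  2≤25 : 2 ≤ 25
  2≤25 = m≤m+n 2 23
  shuffle : ∀ b x → 2 * ((2 * b) * x) ≡ (4 * b) * x
  shuffle = solve-∀

-- The random restriction at rate 1 / 2b and its survivors.

module _ {k m : ℕ} {𝓕 : Family n} (unique : Unique 𝓕) (uniform : Uniform k 𝓕)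
  .{{_ : NonZero k}} .{{_ : NonZero m}} where

  private
    C : Subset n → Subset n
    C I = proj₁ (sunflowerOrCover uniform I m)

    B : Subset n → Subset n
    B F = ⋃ (map C (subsets F))

    b : ℕ
    b = 2 ^ k * (m * k)

    instance
      mk≢0 : NonZero (m * k)
      mk≢0 = m*n≢0 m k
      2^k≢0 : NonZero (2 ^ k)
      2^k≢0 = m^n≢0 2 k
      b≢0 : NonZero b
      b≢0 = m*n≢0 (2 ^ k) (m * k)
      2b≢0 : NonZero (2 * b)
      2b≢0 = m*n≢0 2 b

    ∣B∣≤b : ∀ {F} → ∣ F ∣ ≡ k → ∣ B F ∣ ≤ b
    ∣B∣≤b {F} refl = ≤-trans (∣⋃∣≤ C (λ I → proj₁ (proj₂ (sunflowerOrCover uniform I m))) (subsets F))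
      (≤-reflexive (cong (_* (m * k)) (length-subsets F)))

    1+pred : suc (pred (2 * b)) ≡ 2 * b
    1+pred = suc-pred (2 * b)

    -- Here `Q = 2 * b` and `r = b`: as `∣ B F ∣ ≤ b`, the points of `B F` outside `F` are all
    -- avoided with probability at least 1/2.
    restriction = good-restriction (pred (2 * b)) k b B 𝓕 uniform
      (All.map (λ {F} ∣F∣≡k → ≤-trans (+-monoʳ-≤ b (∣B∣≤b {F} ∣F∣≡k))
        (≤-reflexive (trans (cong (b +_) (sym (+-identityʳ b))) (sym 1+pred)))) uniform)

    R = proj₁ restriction

    survives? : ∀ F → Dec (T (fits R F (B F)))
    survives? F = T? (fits R F (B F))

  abstract
    subfamily : Family n
    subfamily = filter survives? 𝓕

    subfamily-unique : Unique subfamily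
    subfamily-unique = unique-filter⁺ survives? unique

    subfamily-⊑ : subfamily ⊑ 𝓕
    subfamily-⊑ F∈ = proj₁ (∈-filter⁻ survives? F∈)

    length-subfamily : length 𝓕 ≤ length subfamily * (25 * 2 ^ k * k * m) ^ k
    -- The surviving fraction is at least `b / (2 * b) ^ suc k`; cancelling `b` leaves
    -- `1 / (2 * (2 * b) ^ k)`.
    length-subfamily = *-cancelʳ-≤ (length 𝓕) _ b (begin
      length 𝓕 * b                                      ≤⟨ proj₂ restriction ⟩
      length subfamily * suc (pred (2 * b)) ^ suc k     ≡⟨ cong (λ Q → length subfamily * Q ^ suc k) 1+pred ⟩
      length subfamily * (2 * b * (2 * b) ^ k)          ≡⟨ shuffle (length subfamily) b ((2 * b) ^ k) ⟩
      length subfamily * (2 * (2 * b) ^ k) * b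
        ≤⟨ *-monoˡ-≤ b (*-monoʳ-≤ (length subfamily) (2*[2b]^k≤[25b]^k b k)) ⟩
      length subfamily * (25 * b) ^ k * b
        ≡⟨ cong (λ c → length subfamily * c ^ k * b) (shuffle′ (2 ^ k) k m) ⟩
      length subfamily * (25 * 2 ^ k * k * m) ^ k * b   ∎)
      where
      open ≤-Reasoning
      shuffle′ : ∀ a k m → 25 * (a * (m * k)) ≡ 25 * a * k * m
      shuffle′ = solve-∀
      shuffle : ∀ a b c → a * (2 * b * c) ≡ a * (2 * c) * b
      shuffle = solve-∀

    survivor : ∀ {F} → F ∈ subfamily → T (fits R F (B F))
    survivor F∈ = proj₂ (∈-filter⁻ survives? {xs = 𝓕} F∈)

  private
    ⊆R : ∀ {F} → F ∈ subfamily → F ⊆ R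
    ⊆R {F} F∈ = fits⇒⊆ R F (B F) (survivor F∈)

    -- Since `I ⊆ F`, the set `C I` is one of those united in `B F`.
    C∩R⊆ : ∀ {F I} → F ∈ subfamily → I ⊆ F → C I ∩ R ⊆ F
    C∩R⊆ {F} {I} F∈ I⊆F x∈ =
      let x∈C , x∈R = x∈p∩q⁻ (C I) R x∈
      in fits⇒∩⊆ R F (B F) (survivor F∈) (x∈p∩q⁺ (⊆⋃ C (⊆⇒∈-subsets I F I⊆F) x∈C , x∈R))

  closed⇒kernel : ∀ {F I} → F ∈ subfamily → I ⊆ F → F ⊈ I → Closed subfamily I → SunflowerIn 𝓕 m I
  closed⇒kernel {F} {I} F∈ I⊆F F⊈I closed with proj₂ (proj₂ (sunflowerOrCover uniform I m))
  ... | inj₁ S      = S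
  ... | inj₂ covers = contradiction
    (λ {x} x∈ → let x∈F , x∈C = x∈p∩q⁻ F (C I) x∈ in
      -- As `x` lies in `F ⊆ R`, every survivor above `I` contains it, and closedness puts it in
      -- `I`; so `F ∩ C I ⊆ I`, against `covers`.
      closed x (All.tabulate λ G∈ I⊆G → C∩R⊆ G∈ I⊆G (x∈p∩q⁺ (x∈C , ⊆R F∈ x∈F))))
    (covers (subfamily-⊑ F∈) I⊆F F⊈I)

  ∩∈properIntersections : ∀ {F} → F ∈ subfamily → ISub F subfamily (properIntersections subfamily F)
  ∩∈properIntersections {F} F∈ {G} G∈ G≢F = ∈-properIntersections⁺ subfamily F (p∩q⊆p F G)
    (∩-member-proper uniform (subfamily-⊑ F∈) (subfamily-⊑ G∈) G≢F)
    (closed-∩ (closed-∈ F∈) (closed-∈ G∈))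

  properIntersections-kernel : ∀ {F I} → F ∈ subfamily → I ∈ properIntersections subfamily F →
    SunflowerIn 𝓕 m I
  properIntersections-kernel {F} F∈ I∈ =
    let I⊆F , F⊈I , closed = ∈-properIntersections⁻ subfamily F I∈
    in closed⇒kernel F∈ I⊆F F⊈I closed

-- The degenerate uniformity `k = 0`, and parts (a) and (b) together.

theorem1p7 : ∀ (n k m : ℕ) (𝓕 : Family n) → Unique 𝓕 → Uniform k 𝓕 → 2 ≤ m →
    Σ (Family n) λ 𝓕′ → Unique 𝓕′ × 𝓕′ ⊑ 𝓕
    × length 𝓕 ≤ length 𝓕′ * (25 * 2 ^ k * k * m) ^ k
    × (∀ {F₁ F₂} → F₁ ∈ 𝓕′ → F₂ ∈ 𝓕′ → F₁ ≢ F₂ → SunflowerIn 𝓕 m (F₁ ∩ F₂))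
    × (∀ {F} → F ∈ 𝓕′ → Σ (Family n) λ 𝓘 →
    IntersectionClosed 𝓘 × ISub F 𝓕′ 𝓘 × ProperSubsetsOf F 𝓘
    × (∀ {I} → I ∈ 𝓘 → SunflowerIn 𝓕 m I))
theorem1p7 n k m 𝓕 unique uniform 2≤m with k ≟ 0
-- Only the empty set has size 0, so there are no two distinct members; all of `𝓕` is kept and the
-- empty system serves for (b).
... | yes refl =
    𝓕 , unique , (λ F∈ → F∈) , ≤-reflexive (sym (*-identityʳ (length 𝓕)))
  , (λ F₁∈ F₂∈ F₁≢F₂ → contradiction (all-equal F₁∈ F₂∈) F₁≢F₂)
  , λ F∈ → [] , (λ ()) , (λ G∈ G≢F → contradiction (all-equal G∈ F∈) G≢F) , (λ ()) , (λ ())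
  where
  empty : ∀ {A} → A ∈ 𝓕 → ⊥ ≡ A
  empty A∈ = ∣p∣≡∣q∣∧p⊆q⇒p≡q (trans (∣⊥∣≡0 n) (sym (All.lookup uniform A∈))) ⊥⊆
  all-equal : ∀ {A A′} → A ∈ 𝓕 → A′ ∈ 𝓕 → A ≡ A′
  all-equal A∈ A′∈ = trans (sym (empty A∈)) (empty A′∈)
... | no k≢0 =
    subfamily unique uniform
  , subfamily-unique unique uniform
  , subfamily-⊑ unique uniform
  , length-subfamily unique uniform
  -- Part (a) follows from (b): `F₁ ∩ F₂` belongs to the system chosen for `F₁`.
  , (λ {F₁} F₁∈ F₂∈ F₁≢F₂ → properIntersections-kernel unique uniform {F₁} F₁∈
      (∩∈properIntersections unique uniform {F₁} F₁∈ F₂∈ (F₁≢F₂ ∘ sym)))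
  , λ {F} F∈ → properIntersections (subfamily unique uniform) F
    , properIntersections-closed (subfamily unique uniform) F
    , ∩∈properIntersections unique uniform {F} F∈
    , properIntersections-proper (subfamily unique uniform) F
    , properIntersections-kernel unique uniform {F} F∈
  where
  instance
    k-nonZero : NonZero k
    k-nonZero = ≢-nonZero k≢0
    m-nonZero : NonZero m
    m-nonZero = >-nonZero (<⇒≤ 2≤m)
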